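{- Let $G$ be a graph with $n$ vertices and $M=M[IAS(G)]$. Then \[\kappa_B(G)=\begin{cases}\frac{\kappa(M)+1}{2}&\text{if }\kappa(M)<n,\\ \infty&\text{otherwise.}\end{cases}\]
   Context: A graph is a finite looped simple graph; $A=A(G)$ is its $GF(2)$ adjacency matrix (diagonal entry $1$ iff looped, off-diagonal entries record non-loop adjacency), and $n=|V(G)|$. $M[IAS(G)]$ is the binary matroid represented by $(I\;A\;A+I)$. For a matroid $M$ on $W$ with rank $r$, $\lambda(S)=r(S)+r(W-S)-r(M)$; $S$ is a vertical $k$-separation if $\lambda(S)<k$ and $r(S),r(W-S)\ge k$; $\kappa(M)=\min(\{k\mid M\text{ has a vertical }k\text{ -separation}\}\cup\{r(M)\})$. The cut-rank of $X\subseteq V(G)$ is $c_G(X)=r(A[V(G)-X,X])$, the $GF(2)$-rank of the submatrix with rows in $V(G)-X$ and columns in $X$ (empty matrix has rank 0). A subset $X\subseteq V(G)$ is an isotropic $k$-separation if $|X|,|V(G)-X|\ge k$ and $c_G(X)<k$. The isotropic connectivity $\kappa_B(G)$ is the least $k$ such that $G$ has an isotropic $k$-separation, or $\infty$ if there is none. -}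

module Defs where

open import Data.Bool using (Bool; true; false; if_then_else_; _∧_; _∨_; _xor_; not)
open import Data.Nat using (ℕ; zero; suc; _+_; _∸_; _⊔_; _<_; _≤_; _≥_)
open import Data.Fin using (Fin; splitAt; _≟_)
import Data.Fin as F
open import Data.Fin.Subset using (Subset; ∣_∣; ∁)
open import Data.Vec using (Vec; []; _∷_; lookup)
open import Data.List using (List; _++_; map; foldr) renaming ([] to []ᴸ; _∷_ to _∷ᴸ_)
open import Data.Sum using (_⊎_; inj₁; inj₂)
open import Data.Product using (Σ; _×_)
open import Relation.Nullary.Decidable using (⌊_⌋)
open import Relation.Binary.PropositionalEquality using (_≡_)

-- Looped simple graphs on vertex set Fin n, given by their GF(2)
-- adjacency matrix (Bool = GF(2), xor = addition): symmetric, with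
-- diagonal entry true iff the vertex is looped.

record Graph (n : ℕ) : Set where
  field
    adj : Fin n → Fin n → Bool
    adj-sym : ∀ i j → adj i j ≡ adj j i
open Graph public

-- GF(2) linear algebra on a family of column vectors
-- c : Fin m → (Fin r → Bool)  (column j of an r × m matrix).

subsets : (m : ℕ) → List (Subset m)
subsets zero = [] ∷ᴸ []ᴸ
subsets (suc m) = map (true ∷_) (subsets m) ++ map (false ∷_) (subsets m)

allB : (k : ℕ) → (Fin k → Bool) → Bool
allB zero f = true
allB (suc k) f = f F.zero ∧ allB k (λ i → f (F.suc i))

subB : {m : ℕ} → Subset m → Subset m → Bool
subB {m} U T = allB m (λ i → not (lookup U i) ∨ lookup T i)

nonempty : {m : ℕ} → Subset m → Bool
nonempty {m} U = not (allB m (λ i → not (lookup U i)))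

sumCols : {m r : ℕ} → (Fin m → Fin r → Bool) → Subset m → Fin r → Bool
sumCols {zero} c [] i = false
sumCols {suc m} c (b ∷ U) i =
  (if b then c F.zero i else false) xor sumCols (λ j → c (F.suc j)) U i

isZeroVec : {r : ℕ} → (Fin r → Bool) → Bool
isZeroVec {r} v = allB r (λ i → not (v i))

allL : {A : Set} → (A → Bool) → List A → Bool
allL p = foldr (λ x b → p x ∧ b) true

independent : {m r : ℕ} → (Fin m → Fin r → Bool) → Subset m → Bool
independent {m} c T =
  allL (λ U → not (subB U T ∧ nonempty U) ∨ not (isZeroVec (sumCols c U)))
       (subsets m)

rank : {m r : ℕ} → (Fin m → Fin r → Bool) → Subset m → ℕ
rank {m} c S =
  foldr _⊔_ 0
    (map (λ T → if subB T S ∧ independent c T then ∣ T ∣ else 0) (subsets m))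

full : {m : ℕ} → Subset m
full {zero} = []
full {suc m} = true ∷ full

-- The binary matroid M[IAS(G)] represented by (I  A  A+I):
-- ground set Fin (n + (n + n)); columns 0..n-1 are I, then A, then A+I.

eqB : {n : ℕ} → Fin n → Fin n → Bool
eqB i j = ⌊ i ≟ j ⌋

IAS : {n : ℕ} → Graph n → Fin (n + (n + n)) → Fin n → Bool
IAS {n} G j row with splitAt n j
... | inj₁ i = eqB row i
... | inj₂ j' with splitAt n j'
...   | inj₁ i = adj G row i
...   | inj₂ i = adj G row i xor eqB row i

rM : {n : ℕ} → Graph n → Subset (n + (n + n)) → ℕ
rM G = rank (IAS G)

-- connectivity function λ(S) = r(S) + r(W - S) - r(M)
-- (the truncated subtraction never truncates, by submodularity)
conn : {n : ℕ} → Graph n → Subset (n + (n + n)) → ℕ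
conn G S = rM G S + rM G (∁ S) ∸ rM G full

VerticalSep : {n : ℕ} → Graph n → ℕ → Subset (n + (n + n)) → Set
VerticalSep G k S = (conn G S < k) × (rM G S ≥ k) × (rM G (∁ S) ≥ k)

IsLeast : (ℕ → Set) → ℕ → Set
IsLeast P m = P m × (∀ k → P k → m ≤ k)

IsKappa : {n : ℕ} → Graph n → ℕ → Set
IsKappa {n} G κ =
  IsLeast (λ k → Σ (Subset (n + (n + n))) (VerticalSep G k) ⊎ k ≡ rM G full) κ

-- Cut-rank c_G(X) = rank of A[V(G) - X, X].  Rows outside V(G) - X are
-- replaced by zero rows (which does not change the rank); columns are
-- those indexed by X.

cutCols : {n : ℕ} → Graph n → Subset n → Fin n → Fin n → Bool
cutCols G X col row = if lookup X row then false else adj G row col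

cutRank : {n : ℕ} → Graph n → Subset n → ℕ
cutRank G X = rank (cutCols G X) X

IsotropicSep : {n : ℕ} → Graph n → ℕ → Subset n → Set
IsotropicSep G k X = (∣ X ∣ ≥ k) × (∣ ∁ X ∣ ≥ k) × (cutRank G X < k)

HasIsotropicSep : {n : ℕ} → Graph n → ℕ → Set
HasIsotropicSep {n} G k = Σ (Subset n) (IsotropicSep G k)

{-# OPTIONS --safe #-}

-- For X ⊆ V let τ(X) be the set of the 3|X| elements of M that belong to vertices
-- of X.  Then r(τ(X)) = |X| + c(X), and c(X) = c(V − X), so λ(τ(X)) = 2c(X).  Hence
-- an X with c(X) < |X|, |V − X| makes τ(X) a vertical (2c(X) + 1)-separation.
-- Conversely, given a vertical k-separation S, let X consist of the vertices with at
-- least two of their three elements in S.  The three columns of a vertex sum to zero,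
-- so τ(X) ⊆ cl(S) and τ(V − X) ⊆ cl(W − S), whence 2c(X) ≤ λ(S) < k.  Since
-- λ(S) < k ≤ r(S), r(W − S), neither S nor W − S has full rank, so neither have τ(X)
-- and τ(V − X), which says c(X) < |V − X| and c(X) < |X|.

module Submission where

open import Defs
open import Algebra.Bundles using (CommutativeRing)
import Algebra.Properties.Semiring.Sum as SemiringSum
open import Data.Bool using (Bool; true; false; if_then_else_; _∧_; _∨_; _xor_; not)
import Data.Bool as Bool
open import Data.Bool.Properties using (xor-∧-commutativeRing; xor-same; xor-comm; xor-identityʳ; ∧-distribʳ-xor; ∧-zeroʳ; ∧-comm; ∨-zeroʳ; not-involutive)
import Data.Fin as Fin
open import Data.Fin using (Fin; zero; suc; _↑ˡ_; _↑ʳ_; splitAt; combine; finToFun; funToFin)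
open import Data.Fin.Properties using (all?; injective⇒≤; 2↔Bool; funToFin-finToFin; finToFun-funToFin; splitAt-↑ˡ; splitAt-↑ʳ; join-splitAt)
open import Data.Fin.Subset using (Subset; ∣_∣; ∁)
open import Data.Fin.Subset.Properties using (anySubset?; ∣∁p∣≡n∸∣p∣; ∣p∣≤n)
open import Data.List using (foldr; map) renaming ([] to []ᴸ; _∷_ to _∷ᴸ_)
open import Data.List.Membership.Propositional using (_∈_)
open import Data.List.Membership.Propositional.Properties using (∈-++⁺ˡ; ∈-++⁺ʳ; ∈-map⁺)
open import Data.List.Relation.Unary.Any using (here; there)
open import Data.Nat using (ℕ; zero; suc; _+_; _*_; _∸_; _^_; _⊔_; _<_; _≤_; z≤n; s≤s)
open import Data.Nat.Properties
open import Data.Nat.Tactic.RingSolver using (solve-∀)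
open import Data.Product using (Σ; ∃; _×_; _,_; proj₁; proj₂)
open import Data.Sum using (inj₁; inj₂)
open import Data.Vec using ([]; _∷_; lookup; tabulate; _++_)
open import Data.Vec.Properties using (lookup∘tabulate; lookup-++ˡ; lookup-++ʳ; lookup-map; map-++)
import Data.Vec.Functional as Vector
import Data.Vec.Functional.Properties as Vector
open import Function using (_∘_; case_of_)
open import Function.Bundles using (Inverse)
open import Relation.Binary.PropositionalEquality using (_≡_; _≗_; refl; sym; trans; cong; cong₂; subst; module ≡-Reasoning)
open import Relation.Nullary using (¬_; Dec; yes; no; contradiction)
import Relation.Nullary.Decidable as Dec

open SemiringSum (CommutativeRing.semiring xor-∧-commutativeRing)
  using (sum; sum-cong-≗; ∑-distrib-+; sum-replicate-zero)

private variable
  k l m n r : ℕ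

-- Linear algebra over GF(2)

Vect : ℕ → Set
Vect r = Fin r → Bool

0ᵛ : Vect r
0ᵛ _ = false

infixl 6 _⊕_
_⊕_ : Vect r → Vect r → Vect r
(x ⊕ y) i = x i xor y i

comb : Vect m → (Fin m → Vect r) → Vect r
comb a v i = sum λ j → a j ∧ v j i

Span : (Fin m → Vect r) → Vect r → Set
Span v x = ∃ λ a → comb a v ≗ x

Indep : (Fin m → Vect r) → Set
Indep v = ∀ a → comb a v ≗ 0ᵛ → a ≗ 0ᵛ

xor-false⇒≡ : ∀ x y → x xor y ≡ false → x ≡ y
xor-false⇒≡ false false _ = refl
xor-false⇒≡ true true _ = refl

true⇒≡ : ∀ {x y} → (x ≡ true → y ≡ true) → (y ≡ true → x ≡ true) → x ≡ y
true⇒≡ {true} f g = sym (f refl)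
true⇒≡ {false} {false} f g = refl
true⇒≡ {false} {true} f g = g refl

comb-⊕ : ∀ a b (v : Fin m → Vect r) → comb (a ⊕ b) v ≗ comb a v ⊕ comb b v
comb-⊕ a b v i = trans
  (sum-cong-≗ λ j → ∧-distribʳ-xor (v j i) (a j) (b j))
  (∑-distrib-+ (λ j → a j ∧ v j i) (λ j → b j ∧ v j i))

comb-0 : ∀ (v : Fin m → Vect r) → comb 0ᵛ v ≗ 0ᵛ
comb-0 {m} v i = sum-replicate-zero m

comb-congˡ : ∀ {a b} (v : Fin m → Vect r) → a ≗ b → comb a v ≗ comb b v
comb-congˡ v a≗b i = sum-cong-≗ λ j → cong (_∧ v j i) (a≗b j)

-- Over GF(2) the only scalars are 0 and 1, so closure under `⊕` together with `has-0` covers linear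
-- combinations. Vectors are functions compared pointwise, so `resp` has to be demanded explicitly.
record Subspace (P : Vect r → Set) : Set where
  field
    resp : ∀ {x y} → x ≗ y → P x → P y
    has-0 : P 0ᵛ
    has-⊕ : ∀ {x y} → P x → P y → P (x ⊕ y)
open Subspace

comb-closed : ∀ {P : Vect r → Set} → Subspace P → {v : Fin m → Vect r} →
  (∀ j → P (v j)) → ∀ a → P (comb a v)
comb-closed {m = zero} sub Pv a = has-0 sub
comb-closed {m = suc m} sub {v} Pv a with a zero
... | true = has-⊕ sub (Pv zero) (comb-closed sub (Pv ∘ suc) (a ∘ suc))
... | false = comb-closed sub (Pv ∘ suc) (a ∘ suc)

span-⊆ : ∀ {P : Vect r → Set} → Subspace P → {v : Fin m → Vect r} →
  (∀ j → P (v j)) → ∀ {x} → Span v x → P x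
span-⊆ sub Pv (a , eq) = resp sub eq (comb-closed sub Pv a)

span-subspace : ∀ (v : Fin m → Vect r) → Subspace (Span v)
span-subspace v = record
  { resp = λ x≗y (a , eq) → a , λ i → trans (eq i) (x≗y i)
  ; has-0 = 0ᵛ , comb-0 v
  ; has-⊕ = λ (a , eq) (b , eq′) → a ⊕ b , λ i →
      trans (comb-⊕ a b v i) (cong₂ _xor_ (eq i) (eq′ i))
  }

guard : ∀ {P : Vect r → Set} → Subspace P → ∀ b {x} → (b ≡ true → P x) → P (λ i → b ∧ x i)
guard sub true Px = Px refl
guard sub false _ = has-0 sub

-- With `b = false` these are the vectors supported on `X`, with `b = true` those supported off `X`.
-- The two coordinate subspaces meet only in zero.
VanishesWhere : Subset r → Bool → Vect r → Set
VanishesWhere X b x = ∀ i → lookup X i ≡ b → x i ≡ false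

vanishes-subspace : ∀ (X : Subset r) b → Subspace (VanishesWhere X b)
vanishes-subspace X b = record
  { resp = λ x≗y x0 i Xi → trans (sym (x≗y i)) (x0 i Xi)
  ; has-0 = λ _ _ → refl
  ; has-⊕ = λ x0 y0 i Xi → cong₂ _xor_ (x0 i Xi) (y0 i Xi)
  }

δ : Fin n → Vect n
δ j i = eqB i j

eqB-suc : ∀ (i j : Fin n) → eqB (suc i) (suc j) ≡ eqB i j
eqB-suc i j = trans (Dec.isYes≗does _) (sym (Dec.isYes≗does _))

comb-δ : ∀ (a : Vect n) → comb a δ ≗ a
comb-δ {suc n} a zero = begin
  (a zero ∧ true) xor sum (λ j → a (suc j) ∧ false)
    ≡⟨ cong₂ _xor_ (∧-comm (a zero) true)
         (trans (sum-cong-≗ λ j → ∧-zeroʳ (a (suc j))) (sum-replicate-zero n)) ⟩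
  a zero xor false
    ≡⟨ xor-identityʳ (a zero) ⟩
  a zero ∎
  where open ≡-Reasoning
comb-δ {suc n} a (suc i) = begin
  (a zero ∧ false) xor sum (λ j → a (suc j) ∧ eqB (suc i) (suc j))
    ≡⟨ cong₂ _xor_ (∧-zeroʳ (a zero)) (sum-cong-≗ λ j → cong (a (suc j) ∧_) (eqB-suc i j)) ⟩
  comb (a ∘ suc) δ i
    ≡⟨ comb-δ (a ∘ suc) i ⟩
  a (suc i) ∎
  where open ≡-Reasoning

comb-δˡ : ∀ (v : Fin m → Vect r) j → comb (λ l → eqB j l) v ≗ v j
comb-δˡ v j i = trans (sum-cong-≗ λ l → ∧-comm (eqB j l) (v l i)) (comb-δ (λ l → v l i) j)

span-generator : ∀ (v : Fin m → Vect r) j → Span v (v j)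
span-generator v j = (λ l → eqB j l) , comb-δˡ v j

δ-indep : Indep (δ {n})
δ-indep a eq i = trans (sym (comb-δ a i)) (eq i)

sum-++ : ∀ m (f : Fin (m + n) → Bool) →
  sum f ≡ sum (f ∘ (_↑ˡ n)) xor sum (f ∘ (m ↑ʳ_))
sum-++ zero f = refl
sum-++ {n} (suc m) f = trans (cong (f zero xor_) (sum-++ m (f ∘ suc)))
  (sym (CommutativeRing.+-assoc xor-∧-commutativeRing (f zero) _ _))

comb-++ : ∀ a (u : Fin m → Vect r) (w : Fin n → Vect r) →
  comb a (u Vector.++ w) ≗ comb (a ∘ (_↑ˡ n)) u ⊕ comb (a ∘ (m ↑ʳ_)) w
comb-++ {m} a u w i = trans (sum-++ m _) (cong₂ _xor_
  (sum-cong-≗ λ j → cong (λ x → a _ ∧ x i) (Vector.lookup-++ˡ u w j))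
  (sum-cong-≗ λ j → cong (λ x → a _ ∧ x i) (Vector.lookup-++ʳ u w j)))

span-++ˡ : ∀ (u : Fin m → Vect r) (w : Fin n → Vect r) {x} → Span u x → Span (u Vector.++ w) x
span-++ˡ u w = span-⊆ (span-subspace _) λ j →
  subst (Span _) (Vector.lookup-++ˡ u w j) (span-generator (u Vector.++ w) _)

span-++ʳ : ∀ (u : Fin m → Vect r) (w : Fin n → Vect r) {x} → Span w x → Span (u Vector.++ w) x
span-++ʳ u w = span-⊆ (span-subspace _) λ j →
  subst (Span _) (Vector.lookup-++ʳ u w j) (span-generator (u Vector.++ w) _)

++-closed : ∀ (P : Vect r → Set) (u : Fin m → Vect r) (w : Fin n → Vect r) →
  (∀ j → P (u j)) → (∀ j → P (w j)) → ∀ j → P ((u Vector.++ w) j)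
++-closed {m = m} P u w Pu Pw j with splitAt m j
... | inj₁ j′ = Pu j′
... | inj₂ j′ = Pw j′

-- Over GF(2) a vanishing sum means that its two halves are the same vector. That vector lies in
-- both spans, hence is zero, and each family's independence then kills its own coefficients.
indep-++ : ∀ {u : Fin m → Vect r} {w : Fin n → Vect r} → Indep u → Indep w →
  (∀ x → Span u x → Span w x → x ≗ 0ᵛ) → Indep (u Vector.++ w)
indep-++ {m} {n = n} {u} {w} iu iw meet a eq j with splitAt m j | join-splitAt m n j
... | inj₁ j′ | refl = iu (a ∘ (_↑ˡ n)) common j′
  where
  common : comb (a ∘ (_↑ˡ n)) u ≗ 0ᵛ
  common = meet _ (_ , λ _ → refl) (_ , λ i → sym (xor-false⇒≡ _ _ (trans (sym (comb-++ a u w i)) (eq i))))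
... | inj₂ j′ | refl = iw (a ∘ (m ↑ʳ_)) common j′
  where
  common : comb (a ∘ (m ↑ʳ_)) w ≗ 0ᵛ
  common = meet _ (_ , λ i → xor-false⇒≡ _ _ (trans (sym (comb-++ a u w i)) (eq i))) (_ , λ _ → refl)

-- Associativity of the matrix product: (aC)w = a(Cw).
comb-comb : ∀ (a : Vect m) (C : Fin m → Vect k) (w : Fin k → Vect r) →
  comb (comb a C) w ≗ comb a (λ j → comb (C j) w)
comb-comb {m = zero} a C w i = comb-0 w i
comb-comb {m = suc m} a C w i = trans
  (comb-⊕ (λ l → a zero ∧ C zero l) (comb (a ∘ suc) (C ∘ suc)) w i)
  (cong₂ _xor_ (scale (a zero)) (comb-comb (a ∘ suc) (C ∘ suc) w i))
  where
  scale : ∀ b → comb (λ l → b ∧ C zero l) w i ≡ b ∧ comb (C zero) w i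
  scale true = refl
  scale false = comb-0 w i

-- Numbering the 2^m coefficient vectors turns a comparison of dimensions into an injection between
-- finite sets.
encode : Vect m → Fin (2 ^ m)
encode x = funToFin (Inverse.from 2↔Bool ∘ x)

decode : Fin (2 ^ m) → Vect m
decode i = Inverse.to 2↔Bool ∘ finToFun i

decode-encode : ∀ (x : Vect m) → decode (encode x) ≗ x
decode-encode x i = trans (cong (Inverse.to 2↔Bool) (finToFun-funToFin _ i))
  (Inverse.strictlyInverseˡ 2↔Bool (x i))

funToFin-cong : ∀ {f g : Fin k → Fin l} → f ≗ g → funToFin f ≡ funToFin g
funToFin-cong {zero} f≗g = refl
funToFin-cong {suc k} f≗g = cong₂ combine (f≗g zero) (funToFin-cong (f≗g ∘ suc))

encode-cong : ∀ {x y : Vect m} → x ≗ y → encode x ≡ encode y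
encode-cong x≗y = funToFin-cong λ j → cong (Inverse.from 2↔Bool) (x≗y j)

encode-decode : ∀ (i : Fin (2 ^ m)) → encode (decode {m} i) ≡ i
encode-decode {m} i = trans
  (funToFin-cong λ j → Inverse.strictlyInverseʳ 2↔Bool (finToFun {2} {m} i j))
  (funToFin-finToFin {m} i)

-- Sending coefficients over v to coefficients over w embeds GF(2)^m in GF(2)^k.
steinitz : ∀ {v : Fin m → Vect r} {w : Fin k → Vect r} →
  Indep v → (∀ j → Span w (v j)) → m ≤ k
steinitz {m} {k = k} {v} {w} iv spans = ≮⇒≥ λ k<m →
  <⇒≱ (^-monoʳ-< 2 (s≤s (s≤s z≤n)) k<m) (injective⇒≤ {f = f} f-injective)
  where
  C : Fin m → Vect k
  C j = proj₁ (spans j)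
  f : Fin (2 ^ m) → Fin (2 ^ k)
  f i = encode (comb (decode {m} i) C)
  comb-C : ∀ a → comb (comb a C) w ≗ comb a v
  comb-C a i = trans (comb-comb a C w i) (sum-cong-≗ λ j → cong (a j ∧_) (proj₂ (spans j) i))
  f-injective : ∀ {i j} → f i ≡ f j → i ≡ j
  f-injective {i} {j} fi≡fj = begin
    i ≡⟨ encode-decode {m} i ⟨
    encode a ≡⟨ encode-cong (λ l → xor-false⇒≡ _ _ (iv (a ⊕ b) diff l)) ⟩
    encode b ≡⟨ encode-decode {m} j ⟩
    j ∎
    where
    open ≡-Reasoning
    a b : Vect m
    a = decode {m} i
    b = decode {m} j
    same : comb a C ≗ comb b C
    same l = trans (sym (decode-encode _ l)) (trans (cong (λ h → decode {k} h l) fi≡fj) (decode-encode _ l))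
    diff : comb (a ⊕ b) v ≗ 0ᵛ
    diff t = begin
      comb (a ⊕ b) v t ≡⟨ comb-⊕ a b v t ⟩
      comb a v t xor comb b v t ≡⟨ cong₂ _xor_ (comb-C a t) (comb-C b t) ⟨
      comb (comb a C) w t xor comb (comb b C) w t ≡⟨ cong (_xor comb (comb b C) w t) (comb-congˡ w same t) ⟩
      comb (comb b C) w t xor comb (comb b C) w t ≡⟨ xor-same (comb (comb b C) w t) ⟩
      false ∎

-- There are finitely many coefficient vectors, so exhaustive search decides membership. This is
-- what lets a basis be chosen constructively.
span? : ∀ (v : Fin m → Vect r) x → Dec (Span v x)
span? v x = Dec.map′ (λ (U , eq) → lookup U , eq)
  (λ (a , eq) → tabulate a , λ i → trans (comb-congˡ v (lookup∘tabulate a) i) (eq i))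
  (anySubset? λ U → all? λ i → comb (lookup U) v i Bool.≟ x i)

-- Families indexed by a subset

_⊑_ : Subset m → Subset m → Set
U ⊑ T = ∀ j → lookup U j ≡ true → lookup T j ≡ true

enum : (T : Subset m) → Fin ∣ T ∣ → Fin m
enum (true ∷ T) zero = zero
enum (true ∷ T) (suc l) = suc (enum T l)
enum (false ∷ T) l = suc (enum T l)

enum-∈ : ∀ (T : Subset m) l → lookup T (enum T l) ≡ true
enum-∈ (true ∷ T) zero = refl
enum-∈ (true ∷ T) (suc l) = enum-∈ T l
enum-∈ (false ∷ T) l = enum-∈ T l

enum-surjective : ∀ (T : Subset m) j → lookup T j ≡ true → ∃ λ l → enum T l ≡ j
enum-surjective (true ∷ T) zero _ = zero , refl
enum-surjective (true ∷ T) (suc j) Tj with l , eq ← enum-surjective T j Tj = suc l , cong suc eq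
enum-surjective (false ∷ T) (suc j) Tj with l , eq ← enum-surjective T j Tj = l , cong suc eq

sum-enum : ∀ (T : Subset m) f → sum (f ∘ enum T) ≡ sum (λ j → lookup T j ∧ f j)
sum-enum [] f = refl
sum-enum (true ∷ T) f = cong (f zero xor_) (sum-enum T (f ∘ suc))
sum-enum (false ∷ T) f = sum-enum T (f ∘ suc)

comb-enum : ∀ (T : Subset m) (a : Vect m) (c : Fin m → Vect r) → (∀ j → a j ≡ true → lookup T j ≡ true) →
  comb (a ∘ enum T) (c ∘ enum T) ≗ comb a c
comb-enum T a c a⊑T i = trans (sum-enum T (λ j → a j ∧ c j i))
  (sum-cong-≗ λ j → absorb (a⊑T j))
  where
  absorb : ∀ {t b x} → (b ≡ true → t ≡ true) → t ∧ (b ∧ x) ≡ b ∧ x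
  absorb {t} {false} _ = ∧-zeroʳ t
  absorb {t} {true} b⇒t rewrite b⇒t refl = refl

extend : (T : Subset m) → Vect ∣ T ∣ → Subset m
extend [] a = []
extend (true ∷ T) a = a zero ∷ extend T (a ∘ suc)
extend (false ∷ T) a = false ∷ extend T a

extend-⊑ : ∀ (T : Subset m) a → extend T a ⊑ T
extend-⊑ (true ∷ T) a zero _ = refl
extend-⊑ (true ∷ T) a (suc j) = extend-⊑ T (a ∘ suc) j
extend-⊑ (false ∷ T) a (suc j) = extend-⊑ T a j

extend-enum : ∀ (T : Subset m) a → lookup (extend T a) ∘ enum T ≗ a
extend-enum (true ∷ T) a zero = refl
extend-enum (true ∷ T) a (suc l) = extend-enum T (a ∘ suc) l
extend-enum (false ∷ T) a l = extend-enum T a l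

-- A bridge between two forms of independence: it quantifies over subsets of the ground set, as the
-- Boolean `independent` does, while `Indep (c ∘ enum T)` speaks of the reindexed family.
IndepOn : (Fin m → Vect r) → Subset m → Set
IndepOn c T = ∀ U → U ⊑ T → comb (lookup U) c ≗ 0ᵛ → lookup U ≗ 0ᵛ

indepOn⇒indep : ∀ (c : Fin m → Vect r) T → IndepOn c T → Indep (c ∘ enum T)
indepOn⇒indep c T ic a eq l = trans (sym (extend-enum T a l))
  (ic (extend T a) (extend-⊑ T a) zero-comb (enum T l))
  where
  zero-comb : comb (lookup (extend T a)) c ≗ 0ᵛ
  zero-comb i = trans (sym (comb-enum T _ c (extend-⊑ T a) i))
    (trans (comb-congˡ (c ∘ enum T) (extend-enum T a) i) (eq i))

indep⇒indepOn : ∀ (c : Fin m → Vect r) T → Indep (c ∘ enum T) → IndepOn c T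
indep⇒indepOn c T ic U U⊑T eq j = true⇒≡ absurd λ ()
  where
  absurd : lookup U j ≡ true → false ≡ true
  absurd Uj with l , refl ← enum-surjective T j (U⊑T j Uj) =
    trans (sym (ic (lookup U ∘ enum T) (λ i → trans (comb-enum T _ c U⊑T i) (eq i)) l)) Uj

-- The Boolean rank computes the dimension

allB⇒∀ : ∀ (f : Fin k → Bool) → allB k f ≡ true → ∀ i → f i ≡ true
allB⇒∀ {suc k} f eq i with f zero in f0
allB⇒∀ {suc k} f eq zero | true = f0
allB⇒∀ {suc k} f eq (suc i) | true = allB⇒∀ (f ∘ suc) eq i

∀⇒allB : ∀ (f : Fin k → Bool) → (∀ i → f i ≡ true) → allB k f ≡ true
∀⇒allB {zero} f all = refl
∀⇒allB {suc k} f all rewrite all zero = ∀⇒allB (f ∘ suc) (all ∘ suc)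

allL⇒∈ : ∀ {A : Set} (p : A → Bool) xs → allL p xs ≡ true → ∀ {x} → x ∈ xs → p x ≡ true
allL⇒∈ p (x ∷ᴸ xs) eq x∈ with p x in px
allL⇒∈ p (x ∷ᴸ xs) eq (here refl) | true = px
allL⇒∈ p (x ∷ᴸ xs) eq (there x∈) | true = allL⇒∈ p xs eq x∈

∀⇒allL : ∀ {A : Set} (p : A → Bool) xs → (∀ x → p x ≡ true) → allL p xs ≡ true
∀⇒allL p []ᴸ all = refl
∀⇒allL p (x ∷ᴸ xs) all rewrite all x = ∀⇒allL p xs all

subsets-complete : ∀ (U : Subset m) → U ∈ subsets m
subsets-complete [] = here refl
subsets-complete (true ∷ U) = ∈-++⁺ˡ (∈-map⁺ (true ∷_) (subsets-complete U))
subsets-complete {suc m} (false ∷ U) = ∈-++⁺ʳ (map (true ∷_) (subsets m)) (∈-map⁺ (false ∷_) (subsets-complete U))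

subB⇒⊑ : ∀ (U T : Subset m) → subB U T ≡ true → U ⊑ T
subB⇒⊑ U T eq j Uj with allB⇒∀ _ eq j
... | h rewrite Uj = h

⊑⇒subB : ∀ (U T : Subset m) → U ⊑ T → subB U T ≡ true
⊑⇒subB U T U⊑T = ∀⇒allB _ λ j → implies (U⊑T j)
  where
  implies : ∀ {x y} → (x ≡ true → y ≡ true) → not x ∨ y ≡ true
  implies {false} f = refl
  implies {true} f = f refl

not-true : ∀ {x} → not x ≡ true → x ≡ false
not-true {false} _ = refl

¬nonempty⇒≗0 : ∀ (U : Subset m) → nonempty U ≡ false → lookup U ≗ 0ᵛ
¬nonempty⇒≗0 U eq j = not-true (allB⇒∀ _ (trans (sym (not-involutive _)) (cong not eq)) j)

≗0⇒¬nonempty : ∀ (U : Subset m) → lookup U ≗ 0ᵛ → nonempty U ≡ false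
≗0⇒¬nonempty U U0 = cong not (∀⇒allB _ λ j → cong not (U0 j))

sumCols≗comb : ∀ (c : Fin m → Vect r) U → sumCols c U ≗ comb (lookup U) c
sumCols≗comb c [] i = refl
sumCols≗comb c (true ∷ U) i = cong (c zero i xor_) (sumCols≗comb (c ∘ suc) U i)
sumCols≗comb c (false ∷ U) i = sumCols≗comb (c ∘ suc) U i

independent⇒indepOn : ∀ (c : Fin m → Vect r) T → independent c T ≡ true → IndepOn c T
independent⇒indepOn {m} c T ind U U⊑T eq = ¬nonempty⇒≗0 U
  (extract (⊑⇒subB U T U⊑T)
    (∀⇒allB _ λ i → cong not (trans (sumCols≗comb c U i) (eq i)))
    (allL⇒∈ _ (subsets m) ind (subsets-complete U)))
  where
  extract : ∀ {s e z} → s ≡ true → z ≡ true → not (s ∧ e) ∨ not z ≡ true → e ≡ false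
  extract {e = false} refl refl _ = refl

indepOn⇒independent : ∀ (c : Fin m → Vect r) T → IndepOn c T → independent c T ≡ true
indepOn⇒independent {m} c T ic = ∀⇒allL _ (subsets m) λ U → build λ s z →
  ≗0⇒¬nonempty U (ic U (subB⇒⊑ U T s)
    λ i → trans (sym (sumCols≗comb c U i)) (not-true (allB⇒∀ _ z i)))
  where
  build : ∀ {s e z} → (s ≡ true → z ≡ true → e ≡ false) → not (s ∧ e) ∨ not z ≡ true
  build {false} f = refl
  build {true} {e} {false} f = ∨-zeroʳ (not e)
  build {true} {e} {true} f rewrite f refl refl = refl

foldr-⊔-≤ : ∀ {A : Set} (f : A → ℕ) xs → (∀ x → f x ≤ k) → foldr _⊔_ 0 (map f xs) ≤ k
foldr-⊔-≤ f []ᴸ f≤k = z≤n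
foldr-⊔-≤ f (x ∷ᴸ xs) f≤k = ⊔-lub (f≤k x) (foldr-⊔-≤ f xs f≤k)

≤-foldr-⊔ : ∀ {A : Set} (f : A → ℕ) xs {x} → x ∈ xs → f x ≤ foldr _⊔_ 0 (map f xs)
≤-foldr-⊔ f (x ∷ᴸ xs) (here refl) = m≤m⊔n (f x) _
≤-foldr-⊔ f (x ∷ᴸ xs) (there x∈) = ≤-trans (≤-foldr-⊔ f xs x∈) (m≤n⊔m (f x) _)

-- Every `T` that contributes to the maximum is an independent family inside the span of `w`, so
-- `steinitz` bounds its size. All other sets contribute the default 0.
rank-≤ : ∀ (c : Fin m → Vect r) S (w : Fin k → Vect r) →
  (∀ j → lookup S j ≡ true → Span w (c j)) → rank c S ≤ k
rank-≤ {m} {k = k} c S w spans = foldr-⊔-≤ _ (subsets m) bound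
  where
  bound : ∀ T → (if subB T S ∧ independent c T then ∣ T ∣ else 0) ≤ k
  bound T with subB T S in sub | independent c T in ind
  ... | false | _ = z≤n
  ... | true | false = z≤n
  ... | true | true = steinitz (indepOn⇒indep c T (independent⇒indepOn c T ind))
    λ l → spans (enum T l) (subB⇒⊑ T S sub _ (enum-∈ T l))

rank-≥-∣∣ : ∀ (c : Fin m → Vect r) S T → T ⊑ S → IndepOn c T → ∣ T ∣ ≤ rank c S
rank-≥-∣∣ {m} c S T T⊑S ic = ≤-trans (≤-reflexive (sym value))
  (≤-foldr-⊔ (λ T → if subB T S ∧ independent c T then ∣ T ∣ else 0) (subsets m) (subsets-complete T))
  where
  value : (if subB T S ∧ independent c T then ∣ T ∣ else 0) ≡ ∣ T ∣
  value rewrite ⊑⇒subB T S T⊑S | indepOn⇒independent c T ic = refl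

-- In a relation that uses `v zero` its coefficient is 1, so the relation itself writes `v zero` in
-- terms of the rest.
indep-∷ : ∀ {v : Fin (suc m) → Vect r} → Indep (v ∘ suc) → ¬ Span (v ∘ suc) (v zero) → Indep v
indep-∷ {v = v} iv v0∉ a eq with a zero in a0
... | true = contradiction (a ∘ suc , λ i → sym (xor-false⇒≡ _ _ (eq i))) v0∉
... | false = λ { zero → a0 ; (suc j) → iv (a ∘ suc) eq j }

-- Columns are scanned from last to first, and a column of `S` is kept exactly when the columns kept
-- so far do not span it.
greedy-basis : ∀ (c : Fin m → Vect r) S → ∃ λ T →
  T ⊑ S × Indep (c ∘ enum T) × (∀ j → lookup S j ≡ true → Span (c ∘ enum T) (c j))
greedy-basis c [] = [] , (λ ()) , (λ _ _ ()) , λ ()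
greedy-basis c (s ∷ S) with greedy-basis (c ∘ suc) S
greedy-basis c (false ∷ S) | T , T⊑S , iT , spans =
  false ∷ T , (λ { (suc j) → T⊑S j }) , iT , λ { (suc j) → spans j }
greedy-basis c (true ∷ S) | T , T⊑S , iT , spans with span? (c ∘ suc ∘ enum T) (c zero)
... | yes c0∈ = false ∷ T , (λ { (suc j) → T⊑S j }) , iT , λ { zero _ → c0∈ ; (suc j) → spans j }
... | no c0∉ = true ∷ T , (λ { zero _ → refl ; (suc j) → T⊑S j }) , indep-∷ {v = v} iT c0∉ ,
  λ { zero _ → span-generator v zero
    ; (suc j) Sj → span-⊆ (span-subspace v) (λ l → span-generator v (suc l)) (spans j Sj) }
  where v = c ∘ enum (true ∷ T)

record Basis (c : Fin m → Vect r) (S : Subset m) (b : Fin k → Vect r) : Set where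
  field
    indep : Indep b
    member : ∀ l → ∃ λ j → lookup S j ≡ true × b l ≡ c j
    spanning : ∀ j → lookup S j ≡ true → Span b (c j)
open Basis

-- The greedy set attains the maximum in `rank`: it is a candidate itself, and its columns span all
-- of `S`. Transporting along this equality gives a basis indexed by `Fin (rank c S)`, so rank
-- inequalities become applications of `steinitz` and `rank-≤`.
rank-basis : ∀ (c : Fin m → Vect r) S → ∃ λ (b : Fin (rank c S) → Vect r) → Basis c S b
rank-basis {r = r} c S with T , T⊑S , iT , spans ← greedy-basis c S =
  subst (λ k → ∃ λ (b : Fin k → Vect r) → Basis c S b)
    (≤-antisym (rank-≥-∣∣ c S T T⊑S (indep⇒indepOn c T iT)) (rank-≤ c S (c ∘ enum T) spans))
    (c ∘ enum T , record
      { indep = iT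
      ; member = λ l → enum T l , T⊑S _ (enum-∈ T l) , refl
      ; spanning = spans
      })

-- Cut-rank

-- A basis of the column space factors A[V − X, X] through a space of dimension
-- c(X), and the factorisation transposes.
cutRank-∁-≤ : ∀ (G : Graph n) X → cutRank G (∁ X) ≤ cutRank G X
cutRank-∁-≤ {n} G X with b , basis ← rank-basis (cutCols G X) X =
  rank-≤ (cutCols G (∁ X)) (∁ X) (λ l i → proj₁ (factor i) l) λ j ∁Xj → (λ l → b l j) , λ i →
    trans (sum-cong-≗ λ l → ∧-comm (b l j) (proj₁ (factor i) l))
      (trans (proj₂ (factor i) j) (entry i j ∁Xj))
  where
  -- Columns outside `X` are replaced by zero: `b` need not span them, and the rows of
  -- `cutCols G (∁ X)` at these indices are zero.
  factor : ∀ i → Span b (λ t → lookup X i ∧ cutCols G X i t)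
  factor i = guard (span-subspace b) (lookup X i) (spanning basis i)
  entry : ∀ i j → lookup (∁ X) j ≡ true → lookup X i ∧ cutCols G X i j ≡ cutCols G (∁ X) j i
  entry i j ∁Xj rewrite lookup-map i not X | lookup-map j not X | not-true ∁Xj with lookup X i
  ... | true = adj-sym G j i
  ... | false = refl

∁-involutive : ∀ (X : Subset n) → ∁ (∁ X) ≡ X
∁-involutive [] = refl
∁-involutive (x ∷ X) = cong₂ _∷_ (not-involutive x) (∁-involutive X)

cutRank-∁ : ∀ (G : Graph n) X → cutRank G (∁ X) ≡ cutRank G X
cutRank-∁ G X = ≤-antisym (cutRank-∁-≤ G X)
  (subst (λ Y → cutRank G Y ≤ cutRank G (∁ X)) (∁-involutive X) (cutRank-∁-≤ G (∁ X)))

-- The matroid M[IAS(G)]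

-- The elements of a vertex coming from the blocks I, A and A + I.
φ χ ψ : Fin n → Fin (n + (n + n))
φ {n} v = v ↑ˡ (n + n)
χ {n} v = n ↑ʳ (v ↑ˡ n)
ψ {n} v = n ↑ʳ (n ↑ʳ v)

ground-cases : ∀ (P : Fin (n + (n + n)) → Set) →
  (∀ v → P (φ v)) → (∀ v → P (χ v)) → (∀ v → P (ψ v)) → ∀ j → P j
ground-cases {n} P Pφ Pχ Pψ j with splitAt n j | join-splitAt n (n + n) j
... | inj₁ v | refl = Pφ v
... | inj₂ j′ | refl with splitAt n j′ | join-splitAt n n j′
...   | inj₁ v | refl = Pχ v
...   | inj₂ v | refl = Pψ v

neighbours : Graph n → Fin n → Vect n
neighbours G v row = adj G row v

IAS-φ : ∀ (G : Graph n) v → IAS G (φ v) ≡ δ v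
IAS-φ {n} G v rewrite splitAt-↑ˡ n v (n + n) = refl

IAS-χ : ∀ (G : Graph n) v → IAS G (χ v) ≗ neighbours G v
IAS-χ {n} G v row rewrite splitAt-↑ʳ n (n + n) (v ↑ˡ n) | splitAt-↑ˡ n v n = refl

IAS-ψ : ∀ (G : Graph n) v → IAS G (ψ v) ≗ neighbours G v ⊕ δ v
IAS-ψ {n} G v row rewrite splitAt-↑ʳ n (n + n) (n ↑ʳ v) | splitAt-↑ʳ n n v = refl

τ : Subset n → Subset (n + (n + n))
τ X = X ++ (X ++ X)

∁-τ : ∀ (X : Subset n) → ∁ (τ X) ≡ τ (∁ X)
∁-τ X = trans (map-++ not X (X ++ X)) (cong (∁ X ++_) (map-++ not X X))

lookup-τ-φ : ∀ (X : Subset n) v → lookup (τ X) (φ v) ≡ lookup X v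
lookup-τ-φ X v = lookup-++ˡ X (X ++ X) v

lookup-τ-χ : ∀ (X : Subset n) v → lookup (τ X) (χ v) ≡ lookup X v
lookup-τ-χ X v = trans (lookup-++ʳ X (X ++ X) (v ↑ˡ _)) (lookup-++ˡ X X v)

lookup-τ-ψ : ∀ (X : Subset n) v → lookup (τ X) (ψ v) ≡ lookup X v
lookup-τ-ψ X v = trans (lookup-++ʳ X (X ++ X) (_ ↑ʳ v)) (lookup-++ʳ X X v)

-- The ψ column is the sum of the other two, so membership needs checking only for those.
τ-closed : ∀ (G : Graph n) X {P} → Subspace P →
  (∀ v → lookup X v ≡ true → P (δ v) × P (neighbours G v)) →
  ∀ j → lookup (τ X) j ≡ true → P (IAS G j)
τ-closed G X {P} sub Pv = ground-cases (λ j → lookup (τ X) j ≡ true → P (IAS G j))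
  (λ v Xv → subst P (sym (IAS-φ G v)) (proj₁ (Pv v (trans (sym (lookup-τ-φ X v)) Xv))))
  (λ v Xv → resp sub (λ i → sym (IAS-χ G v i)) (proj₂ (Pv v (trans (sym (lookup-τ-χ X v)) Xv))))
  (λ v Xv → let Pδ , PN = Pv v (trans (sym (lookup-τ-ψ X v)) Xv) in
    resp sub (λ i → sym (IAS-ψ G v i)) (has-⊕ sub PN Pδ))

-- Majority vertices of a set of matroid elements

majority : Bool → Bool → Bool → Bool
majority true y z = y ∨ z
majority false y z = y ∧ z

-- Self-duality of majority: passing from S to W - S turns the set X of majority vertices into V -
-- X, so both sides of a separation can be treated alike.
majority-not : ∀ x y z → majority (not x) (not y) (not z) ≡ not (majority x y z)
majority-not true true z = refl
majority-not true false z = refl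
majority-not false true z = refl
majority-not false false z = refl

vertexMajority : Subset (n + (n + n)) → Fin n → Bool
vertexMajority S v = majority (lookup S (φ v)) (lookup S (χ v)) (lookup S (ψ v))

xor-cancelˡ : ∀ x y → x xor (x xor y) ≡ y
xor-cancelˡ true y = not-involutive y
xor-cancelˡ false y = refl

-- The columns of a vertex sum to zero, so any two of them span the third.
majority-closed : ∀ (G : Graph n) S {P} → Subspace P →
  (∀ j → lookup S j ≡ true → P (IAS G j)) →
  ∀ v → vertexMajority S v ≡ true → P (δ v) × P (neighbours G v)
majority-closed G S {P} sub PS v = two (lookup S (φ v)) (lookup S (χ v)) (lookup S (ψ v))
  (λ Sφ → subst P (IAS-φ G v) (PS (φ v) Sφ))
  (λ Sχ → resp sub (IAS-χ G v) (PS (χ v) Sχ))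
  (λ Sψ → resp sub (IAS-ψ G v) (PS (ψ v) Sψ))
  where
  N = neighbours G v
  two : ∀ x y z → (x ≡ true → P (δ v)) → (y ≡ true → P N) → (z ≡ true → P (N ⊕ δ v)) →
    majority x y z ≡ true → P (δ v) × P N
  two true true z f g h _ = f refl , g refl
  two true false true f g h _ = f refl , resp sub
    (λ i → trans (cong (δ v i xor_) (xor-comm (N i) (δ v i))) (xor-cancelˡ (δ v i) (N i)))
    (has-⊕ sub (f refl) (h refl))
  two false true true f g h _ =
    resp sub (λ i → xor-cancelˡ (N i) (δ v i)) (has-⊕ sub (g refl) (h refl)) , g refl

-- The rank form of τ(X) ⊆ cl(S): a basis of `S` already spans every column of `τ X`.
rM-τ-≤ : ∀ (G : Graph n) X S → (∀ v → lookup X v ≡ true → vertexMajority S v ≡ true) →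
  rM G (τ X) ≤ rM G S
rM-τ-≤ G X S maj with b , basis ← rank-basis (IAS G) S =
  rank-≤ (IAS G) (τ X) b (τ-closed G X (span-subspace b) λ v Xv →
    majority-closed G S (span-subspace b) (spanning basis) v (maj v Xv))

lookup-full : ∀ (i : Fin n) → lookup full i ≡ true
lookup-full zero = refl
lookup-full (suc i) = lookup-full i

-- The block I alone supplies all n unit vectors.
rM-full : ∀ (G : Graph n) → rM G full ≡ n
rM-full G with b , basis ← rank-basis (IAS G) full = ≤-antisym
  (rank-≤ (IAS G) full δ λ j _ → IAS G j , comb-δ (IAS G j))
  (steinitz δ-indep λ v → subst (Span b) (IAS-φ G v) (spanning basis (φ v) (lookup-full (φ v))))

span-δ∘enum : ∀ (X : Subset n) {x} → VanishesWhere X false x → Span (δ ∘ enum X) x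
span-δ∘enum X {x} x0 = x ∘ enum X , λ i →
  trans (comb-enum X x δ (λ j xj → inside j xj (lookup X j) refl) i) (comb-δ x i)
  where
  inside : ∀ j → x j ≡ true → ∀ b → lookup X j ≡ b → b ≡ true
  inside j xj true _ = refl
  inside j xj false Xj = trans (sym (x0 j Xj)) xj

-- The rows of X contribute |X| to the rank of the columns τ(X); what is left is A[V − X, X].
rM-τ : ∀ (G : Graph n) X → rM G (τ X) ≡ ∣ X ∣ + cutRank G X
rM-τ {n} G X with b , basis ← rank-basis (cutCols G X) X | d , basisτ ← rank-basis (IAS G) (τ X) =
  ≤-antisym (rank-≤ (IAS G) (τ X) w (τ-closed G X (span-subspace w) w-spans))
    (steinitz w-indep (++-closed (Span d) (δ ∘ enum X) b δ∈d b∈d))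
  where
  w : Fin (∣ X ∣ + cutRank G X) → Vect n
  w = (δ ∘ enum X) Vector.++ b

  -- The part of column `v` in the rows of `X`. It is a combination of the unit vectors of `X`, and
  -- the rest of the column is `cutCols G X v`; adding it therefore passes between `neighbours G v`
  -- and `cutCols G X v` in either direction.
  onX : Fin n → Vect n
  onX v i = lookup X i ∧ adj G i v

  onX-vanishes : ∀ v → VanishesWhere X false (onX v)
  onX-vanishes v i Xi rewrite Xi = refl

  split : ∀ v → cutCols G X v ⊕ onX v ≗ neighbours G v
  split v i with lookup X i
  ... | true = refl
  ... | false = xor-identityʳ (adj G i v)

  w-spans : ∀ v → lookup X v ≡ true → Span w (δ v) × Span w (neighbours G v)
  w-spans v Xv with l , refl ← enum-surjective X v Xv =
    span-++ˡ (δ ∘ enum X) b (span-generator (δ ∘ enum X) l) ,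
    resp (span-subspace w) (split v) (has-⊕ (span-subspace w)
      (span-++ʳ (δ ∘ enum X) b (spanning basis v Xv))
      (span-++ˡ (δ ∘ enum X) b (span-δ∘enum X (onX-vanishes v))))

  δ∈d : ∀ l → Span d (δ (enum X l))
  δ∈d l = subst (Span d) (IAS-φ G _)
    (spanning basisτ (φ (enum X l)) (trans (lookup-τ-φ X _) (enum-∈ X l)))

  split′ : ∀ v → neighbours G v ⊕ onX v ≗ cutCols G X v
  split′ v i with lookup X i
  ... | true = xor-same (adj G i v)
  ... | false = xor-identityʳ (adj G i v)

  b∈d : ∀ l → Span d (b l)
  b∈d l with v , Xv , eq ← member basis l = subst (Span d) (sym eq)
    (resp (span-subspace d) (split′ v) (has-⊕ (span-subspace d)
      (resp (span-subspace d) (IAS-χ G v) (spanning basisτ (χ v) (trans (lookup-τ-χ X v) Xv)))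
      (span-⊆ (span-subspace d) δ∈d (span-δ∘enum X (onX-vanishes v)))))

  δ-outside : ∀ l → VanishesWhere X false (δ (enum X l))
  δ-outside l i Xi with i Fin.≟ enum X l
  ... | yes refl = trans (sym (enum-∈ X l)) Xi
  ... | no _ = refl

  b-inside : ∀ l → VanishesWhere X true (b l)
  b-inside l i Xi with v , _ , eq ← member basis l = trans (cong (λ x → x i) eq) (cut i Xi)
    where
    cut : VanishesWhere X true (cutCols G X v)
    cut i Xi rewrite Xi = refl

  -- The unit vectors are supported on `X` and `b` off `X`, so a vector in both spans vanishes at
  -- every row.
  w-indep : Indep w
  w-indep = indep-++ (indepOn⇒indep δ X λ U _ → δ-indep (lookup U)) (indep basis) λ x x∈δ x∈b i →
    meet (lookup X i)
      (span-⊆ (vanishes-subspace X false) δ-outside x∈δ i)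
      (span-⊆ (vanishes-subspace X true) b-inside x∈b i)
    where
    meet : ∀ b {x} → (b ≡ false → x ≡ false) → (b ≡ true → x ≡ false) → x ≡ false
    meet true f g = g refl
    meet false f g = f refl

-- Isotropic separations versus vertical separations

∣X∣+∣∁X∣ : ∀ (X : Subset n) → ∣ X ∣ + ∣ ∁ X ∣ ≡ n
∣X∣+∣∁X∣ X = trans (cong (∣ X ∣ +_) (∣∁p∣≡n∸∣p∣ X)) (m+[n∸m]≡n (∣p∣≤n X))

rM-∁τ : ∀ (G : Graph n) X → rM G (∁ (τ X)) ≡ ∣ ∁ X ∣ + cutRank G X
rM-∁τ G X = trans (cong (rM G) (∁-τ X)) (trans (rM-τ G (∁ X)) (cong (∣ ∁ X ∣ +_) (cutRank-∁ G X)))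

conn-τ : ∀ (G : Graph n) X → conn G (τ X) ≡ cutRank G X + cutRank G X
conn-τ {n} G X = begin
  rM G (τ X) + rM G (∁ (τ X)) ∸ rM G full
    ≡⟨ cong₂ _∸_ (cong₂ _+_ (rM-τ G X) (rM-∁τ G X)) (rM-full G) ⟩
  (∣ X ∣ + c) + (∣ ∁ X ∣ + c) ∸ n
    ≡⟨ cong (_∸ n) (+-middle (∣ X ∣) c (∣ ∁ X ∣) c) ⟩
  (∣ X ∣ + ∣ ∁ X ∣) + (c + c) ∸ n
    ≡⟨ cong (λ h → h + (c + c) ∸ n) (∣X∣+∣∁X∣ X) ⟩
  n + (c + c) ∸ n
    ≡⟨ m+n∸m≡n n (c + c) ⟩
  c + c ∎
  where
  open ≡-Reasoning
  c = cutRank G X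
  +-middle : ∀ a b c d → (a + b) + (c + d) ≡ (a + c) + (b + d)
  +-middle = solve-∀

-- The order 2c + 1 is the least above λ(τ(X)) = 2c. Adding c to c + 1 ≤ |X| gives 2c + 1 ≤ r(τ(X)),
-- and likewise for the complement.
isotropic⇒vertical : ∀ (G : Graph n) X → cutRank G X < ∣ X ∣ → cutRank G X < ∣ ∁ X ∣ →
  VerticalSep G (suc (cutRank G X + cutRank G X)) (τ X)
isotropic⇒vertical G X c<∣X∣ c<∣∁X∣ =
  s≤s (≤-reflexive (conn-τ G X)) ,
  ≤-trans (+-monoˡ-≤ (cutRank G X) c<∣X∣) (≤-reflexive (sym (rM-τ G X))) ,
  ≤-trans (+-monoˡ-≤ (cutRank G X) c<∣∁X∣) (≤-reflexive (sym (rM-∁τ G X)))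

vertical⇒isotropic : ∀ (G : Graph n) S → VerticalSep G k S →
  ∃ λ X → cutRank G X < ∣ X ∣ × cutRank G X < ∣ ∁ X ∣ × cutRank G X + cutRank G X < k
vertical⇒isotropic {n} {k} G S (λ<k , k≤r , k≤r′) = X ,
  -- The sides cross over: the rank deficiency of W - S bounds c by |X|, and that of S bounds c by
  -- |V - X|.
  +-cancelˡ-< (∣ ∁ X ∣) _ _ (begin-strict
    ∣ ∁ X ∣ + c ≡⟨ rM-∁τ G X ⟨
    rM G (∁ (τ X)) ≤⟨ ≤S′ ⟩
    rM G (∁ S) <⟨ r′<n ⟩
    n ≡⟨ ∣X∣+∣∁X∣ X ⟨
    ∣ X ∣ + ∣ ∁ X ∣ ≡⟨ +-comm (∣ X ∣) (∣ ∁ X ∣) ⟩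
    ∣ ∁ X ∣ + ∣ X ∣ ∎) ,
  +-cancelˡ-< (∣ X ∣) _ _ (begin-strict
    ∣ X ∣ + c ≡⟨ rM-τ G X ⟨
    rM G (τ X) ≤⟨ ≤S ⟩
    rM G S <⟨ r<n ⟩
    n ≡⟨ ∣X∣+∣∁X∣ X ⟨
    ∣ X ∣ + ∣ ∁ X ∣ ∎) ,
  (begin-strict
    c + c ≡⟨ conn-τ G X ⟨
    rM G (τ X) + rM G (∁ (τ X)) ∸ rM G full ≤⟨ ∸-monoˡ-≤ (rM G full) (+-mono-≤ ≤S ≤S′) ⟩
    conn G S <⟨ λ<k ⟩
    k ∎)
  where
  open ≤-Reasoning
  X : Subset n
  X = tabulate (vertexMajority S)
  c = cutRank G X

  ≤S : rM G (τ X) ≤ rM G S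
  ≤S = rM-τ-≤ G X S λ v Xv → trans (sym (lookup∘tabulate (vertexMajority S) v)) Xv

  majority-∁ : ∀ v → vertexMajority (∁ S) v ≡ lookup (∁ X) v
  majority-∁ v rewrite lookup-map (φ v) not S | lookup-map (χ v) not S | lookup-map (ψ v) not S
    | lookup-map v not X | lookup∘tabulate (vertexMajority S) v =
    majority-not (lookup S (φ v)) (lookup S (χ v)) (lookup S (ψ v))

  ≤S′ : rM G (∁ (τ X)) ≤ rM G (∁ S)
  ≤S′ = subst (λ Y → rM G Y ≤ rM G (∁ S)) (sym (∁-τ X))
    (rM-τ-≤ G (∁ X) (∁ S) λ v ∁Xv → trans (majority-∁ v) ∁Xv)

  sum<n+k : rM G S + rM G (∁ S) < n + k
  sum<n+k = begin-strict
    -- The inequality m ≤ n + (m ∸ n) holds for truncated subtraction too, so λ(S) < k bounds the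
    -- sum of the two ranks. Since each rank is at least k, the other one is then below n.
    rM G S + rM G (∁ S) ≤⟨ m≤n+m∸n _ n ⟩
    n + (rM G S + rM G (∁ S) ∸ n) ≡⟨ cong (λ h → n + (rM G S + rM G (∁ S) ∸ h)) (rM-full G) ⟨
    n + conn G S <⟨ +-monoʳ-< n λ<k ⟩
    n + k ∎

  r<n : rM G S < n
  r<n = +-cancelʳ-< k _ _ (≤-<-trans (+-monoʳ-≤ (rM G S) k≤r′) sum<n+k)

  r′<n : rM G (∁ S) < n
  r′<n = +-cancelʳ-< k _ _ (≤-<-trans
    (≤-trans (+-monoʳ-≤ (rM G (∁ S)) k≤r) (≤-reflexive (+-comm (rM G (∁ S)) (rM G S)))) sum<n+k)

-- Determining the isotropic connectivity from κ

κ-≤-isotropic : ∀ (G : Graph n) {κ} → IsKappa G κ → ∀ X → cutRank G X < ∣ X ∣ → cutRank G X < ∣ ∁ X ∣ →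
  κ ≤ suc (cutRank G X + cutRank G X)
κ-≤-isotropic G (_ , least) X c<∣X∣ c<∣∁X∣ = least _ (inj₁ (τ X , isotropic⇒vertical G X c<∣X∣ c<∣∁X∣))

theorem4 : (n : ℕ) (G : Graph n) (κ : ℕ) → IsKappa G κ →
    (κ < n → Σ ℕ (λ κB → (κB * 2 ≡ κ + 1) × IsLeast (HasIsotropicSep G) κB))
    × (n ≤ κ → ∀ k → ¬ HasIsotropicSep G k)
theorem4 n G κ isκ = finite , infinite
  where
  -- The bound uses the cut-rank c of the given set rather than k. Both sides have at least c + 1
  -- vertices, so 2c + 2 ≤ n.
  κ-bound : ∀ k → HasIsotropicSep G k → ∃ λ c → c < k × κ ≤ suc (c + c) × suc (c + c) < n
  κ-bound k (X , k≤∣X∣ , k≤∣∁X∣ , c<k) =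
    c , c<k , κ-≤-isotropic G isκ X (<-≤-trans c<k k≤∣X∣) (<-≤-trans c<k k≤∣∁X∣) , (begin
      suc (suc (c + c)) ≡⟨ cong suc (+-suc c c) ⟨
      suc c + suc c ≤⟨ +-mono-≤ (≤-trans c<k k≤∣X∣) (≤-trans c<k k≤∣∁X∣) ⟩
      ∣ X ∣ + ∣ ∁ X ∣ ≡⟨ ∣X∣+∣∁X∣ X ⟩
      n ∎)
    where
    open ≤-Reasoning
    c = cutRank G X

  infinite : n ≤ κ → ∀ k → ¬ HasIsotropicSep G k
  infinite n≤κ k sep = let c , _ , κ≤ , <n = κ-bound k sep in <⇒≱ (≤-<-trans κ≤ <n) n≤κ

  least : ∀ X → cutRank G X < ∣ X ∣ → cutRank G X < ∣ ∁ X ∣ → cutRank G X + cutRank G X < κ →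
    Σ ℕ (λ κB → (κB * 2 ≡ κ + 1) × IsLeast (HasIsotropicSep G) κB)
  least X c<∣X∣ c<∣∁X∣ 2c<κ =
    -- The bounds 2c < κ and κ ≤ 2c + 1 force κ = 2c + 1, which makes κ odd and (κ + 1)/2 equal to c
    -- + 1.
    suc c , trans (double c) (cong (_+ 1) (sym κ≡)) , (X , c<∣X∣ , c<∣∁X∣ , ≤-refl) , minimal
    where
    c = cutRank G X
    κ≡ : κ ≡ suc (c + c)
    κ≡ = ≤-antisym (κ-≤-isotropic G isκ X c<∣X∣ c<∣∁X∣) 2c<κ
    double : ∀ c → suc c * 2 ≡ suc (c + c) + 1
    double = solve-∀
    minimal : ∀ k → HasIsotropicSep G k → suc c ≤ k
    -- If k ≤ c, the cut-rank c′ of this separation satisfies c′ < k ≤ c, so κ ≤ 2c′ + 1 < 2c + 1 =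
    -- κ.
    minimal k sep = let c′ , c′<k , κ≤ , _ = κ-bound k sep in ≮⇒≥ λ k≤c →
      <⇒≱ (+-mono-< (<-≤-trans c′<k (≤-pred k≤c)) (<-≤-trans c′<k (≤-pred k≤c)))
        (≤-pred (≤-trans (≤-reflexive (sym κ≡)) κ≤))

  finite : κ < n → Σ ℕ (λ κB → (κB * 2 ≡ κ + 1) × IsLeast (HasIsotropicSep G) κB)
  finite κ<n = case proj₁ isκ of λ
    -- The fallback value r(M) equals n, so κ < n forces κ to come from an actual vertical
    -- κ-separation.
    { (inj₂ κ≡r) → contradiction (trans κ≡r (rM-full G)) (<⇒≢ κ<n)
    ; (inj₁ (S , vsep)) → let X , c<∣X∣ , c<∣∁X∣ , 2c<κ = vertical⇒isotropic G S vsep in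
        least X c<∣X∣ c<∣∁X∣ 2c<κ
    }
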